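{- For every $d\in\mathbb{N}$ and every graph class $\mathscr C$ of bounded expansion, there exists $s\in\mathbb{N}$ such that for every $G\in\mathscr C$, every $W\subseteq V(G)$ and every $\mathcal{Q}\subseteq\{\mathsf{Ball}^G_d(u): u\in V(G)\}$, the set system $(W,\{F\cap W: F\in\mathcal{Q}\})$ has subchromatic number at most $s$. (That is, the hereditary closure of the class of set systems $\mathsf{Balls}_d(\mathscr C)$ has bounded subchromatic number.)
   Context: Graphs are finite, simple, undirected. $\mathsf{Ball}^G_d(u)=\{v\in V(G):\mathrm{dist}_G(u,v)\le d\}$, and $\mathsf{Balls}_d(G)=(V(G),\{\mathsf{Ball}^G_d(u):u\in V(G)\})$. For a set system $(U,\mathcal{F})$ its Gaifman graph has vertex set $U$, with distinct $x,y$ adjacent iff some $F\in\mathcal{F}$ contains both. A cluster graph is a graph whose every connected component is a clique; a subcoloring of a graph $G$ is a map $\lambda\colon V(G)\to C$ (finite $C$) such that $G[\lambda^{ -1}(i)]$ is a cluster graph for each $i$; the subchromatic number of a graph is the minimum number of colors of a subcoloring, and that of a set system is the subchromatic number of its Gaifman graph. A graph $H$ is a depth-$d$ minor of $G$ if one can assign to each $u\in V(H)$ a connected subgraph $\eta(u)$ of $G$ of radius at most $d$, pairwise vertex-disjoint, such that each edge $uv$ of $H$ has a corresponding edge of $G$ between $\eta(u)$ and $\eta(v)$; $\mathscr C$ has bounded expansion if for each $d$ the maximum average degree of depth-$d$ minors of graphs in $\mathscr C$ is bounded. -}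

module Defs where

open import Data.Nat using (ℕ; zero; suc; _+_; _*_; _≤_)
open import Data.Fin using (Fin)
open import Data.Fin.Subset using (Subset; _∈_)
open import Data.Bool using (Bool; true; false; if_then_else_)
open import Data.List using (List; map; allFin)
open import Data.Nat.ListAction using (sum)
open import Data.Product using (Σ; ∃; ∃-syntax; _×_; proj₁)
open import Data.Sum using (_⊎_)
open import Data.Unit using (⊤)
open import Data.Empty using (⊥)
open import Relation.Binary.PropositionalEquality using (_≡_; _≢_)

record Graph : Set where
  field
    n      : ℕ
    adj    : Fin n → Fin n → Bool
    sym    : ∀ u v → adj u v ≡ adj v u
    irrefl : ∀ u → adj u u ≡ false
open Graph public

-- Walks of length ≤ k from u to v all of whose vertices after the start
-- satisfy P.
data WalkIn (G : Graph) (P : Fin (n G) → Set) : ℕ → Fin (n G) → Fin (n G) → Set where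
  here : ∀ {k u} → WalkIn G P k u u
  step : ∀ {k u w v} → adj G u w ≡ true → P w → WalkIn G P k w v → WalkIn G P (suc k) u v

DistLe : (G : Graph) → ℕ → Fin (n G) → Fin (n G) → Set
DistLe G = WalkIn G (λ _ → ⊤)

InBall : (G : Graph) (d : ℕ) (u v : Fin (n G)) → Set
InBall G d u v = DistLe G d u v

-- Degree sum = 2|E(G)|, so the average degree is degSum G / n G.

b2n : Bool → ℕ
b2n true  = 1
b2n false = 0

degree : (G : Graph) → Fin (n G) → ℕ
degree G u = sum (map (λ v → b2n (adj G u v)) (allFin (n G)))

degSum : Graph → ℕ
degSum G = sum (map (degree G) (allFin (n G)))

-- Depth-d minors.  η u is the vertex set of a connected subgraph of G
-- of radius ≤ d (witnessed by a centre from which every vertex of η u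
-- is reached by a walk of length ≤ d inside η u); branch sets are
-- pairwise disjoint and every edge of H is realised by an edge of G.

record IsDepthMinor (d : ℕ) (H G : Graph) : Set where
  field
    η        : Fin (n H) → Subset (n G)
    centre   : Fin (n H) → Fin (n G)
    centre∈  : ∀ u → centre u ∈ η u
    radius   : ∀ u v → v ∈ η u → WalkIn G (λ w → w ∈ η u) d (centre u) v
    disjoint : ∀ u u' v → u ≢ u' → v ∈ η u → v ∈ η u' → ⊥
    edges    : ∀ u u' → adj H u u' ≡ true →
               ∃[ a ] ∃[ b ] (a ∈ η u × b ∈ η u' × adj G a b ≡ true)

-- Bounded expansion: for every d the average degree of depth-d minors
-- of members of the class is bounded (by a natural number c, i.e.
-- 2|E(H)| ≤ c·|V(H)|).
BoundedExpansion : (Graph → Set) → Set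
BoundedExpansion 𝒞 =
  ∀ (d : ℕ) → ∃[ c ] (∀ G → 𝒞 G → ∀ H → IsDepthMinor d H G → degSum H ≤ c * n H)

record SetSystem : Set₁ where
  field
    U     : Set
    I     : Set
    _∈F_  : U → I → Set
open SetSystem public

GaifmanAdj : (S : SetSystem) → U S → U S → Set
GaifmanAdj S x y = x ≢ y × ∃[ i ] (_∈F_ S x i × _∈F_ S y i)

module _ {V : Set} (Adj : V → V → Set) where
  data PathIn (P : V → Set) : V → V → Set where
    here : ∀ {x} → P x → PathIn P x x
    step : ∀ {x z y} → P x → Adj x z → PathIn P z y → PathIn P x y

  -- the induced subgraph on P is a cluster graph: every connected
  -- component is a clique
  IsClusterGraph : (V → Set) → Set
  IsClusterGraph P = ∀ x y → PathIn P x y → x ≡ y ⊎ Adj x y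

  IsSubcoloring : (s : ℕ) → (V → Fin s) → Set
  IsSubcoloring s λc = ∀ (i : Fin s) → IsClusterGraph (λ x → λc x ≡ i)

  GraphSubchromaticLe : ℕ → Set
  GraphSubchromaticLe s = ∃[ λc ] IsSubcoloring s λc

SubchromaticLe : ℕ → SetSystem → Set
SubchromaticLe s S = GraphSubchromaticLe (GaifmanAdj S) s

-- The set system (W, {Ball^G_d(u) ∩ W : u ∈ Q}) where Q ⊆ V(G) is a set of
-- centres, so that {Ball^G_d(u) : u ∈ Q} is an arbitrary subfamily of Balls_d(G).
BallTrace : (G : Graph) (d : ℕ) (W Q : Subset (n G)) → SetSystem
BallTrace G d W Q = record
  { U    = Σ (Fin (n G)) (λ x → x ∈ W)
  ; I    = Σ (Fin (n G)) (λ u → u ∈ Q)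
  ; _∈F_ = λ x u → InBall G d (proj₁ u) (proj₁ x)
  }

{-# OPTIONS --safe #-}
-- Bounded expansion bounds the weak colouring numbers, and weak colouring numbers bound subchromatic numbers.
--
-- Let r = 4d. In every nonempty S ⊆ V(G), some vertex v is separated from the rest of S, as far as walks of length
-- ≤ r are concerned, by a set of bounded size. Indeed, grow disjoint branch sets around the vertices of S, joining
-- two non-touching ones by a short walk outside their union M for as long as possible. Each joining creates a new edge
-- of a shallow minor, so |M| = O(|S|). Take a large independent set I of this minor. By saturation, the radius-r
-- regions of the vertices of I outside M are disjoint; contracting them gives a shallow minor on M, in which some
-- v ∈ I has bounded degree, and its neighbours form the separator.
--
-- Removing such vertices one by one gives a linear order. A walk from v to its minimum y passes through the separator
-- of v, then through the separator of the vertex hit there, and so on, so that y is reached in at most r jumps. Hence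
-- greedy colouring yields φ with φ v ≠ φ y whenever y ≠ v is the minimum of a walk of length ≤ r from v to y.
--
-- Finally let the anchor z of x be the smallest vertex on a walk of length ≤ d from x to Q, and colour x by φ z and
-- the position of z on that walk. If x and y lie in a common ball, the walk from anchor to anchor through x, the centre
-- and y has one of the anchors as its minimum, so equal colours force equal anchors. Hence a monochromatic component
-- has a single anchor, at a single distance, and the element of Q nearest to it sees the whole component.

module Submission where

open import Defs
open import Data.Nat using (ℕ)
open import Data.Product using (∃-syntax)
open import Data.Fin.Subset using (Subset)
import Data.Nat.Properties
open import Algebra.Properties.Semiring.Sum Data.Nat.Properties.+-*-semiring
  using (sum; sum-syntax; sum-cong-≗; ∑-distrib-+; ∑-comm; *-distribˡ-sum)
open import Data.Bool using (Bool; true; false; _∧_; _∨_; not; if_then_else_)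
import Data.Bool.Properties as Bool
open import Data.Empty using (⊥; ⊥-elim)
open import Data.Fin using (Fin; zero; suc; toℕ; fromℕ<; combine)
open import Data.Fin.Properties using (_≟_; any?; toℕ<n; toℕ-fromℕ<; suc-injective; combine-injective)
open import Data.List using (List; []; _∷_; length; map; tabulate; allFin; concatMap)
open import Data.List.Properties using (map-tabulate; length-map; length-++)
open import Data.List.Membership.Propositional using (_∈_; _∉_; lose)
import Data.List.Membership.DecPropositional as DecMembership
open import Data.List.Membership.Propositional.Properties using (∈-map⁺; ∈-allFin; ∈-concatMap⁺)
open import Data.List.Relation.Unary.Any using (here; there)
open import Data.Maybe using (Maybe; just; nothing; is-just)
open import Data.Maybe.Properties using (≡-dec; just-injective)
open import Data.Nat using (zero; suc; _+_; _*_; _∸_; _≤_; _<_; z≤n; s≤s; s≤s⁻¹; _≤?_)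
open import Data.Nat.ListAction using () renaming (sum to listSum)
open import Data.Nat.Properties hiding (suc-injective) renaming (_≟_ to _≟ℕ_)
open import Data.Product using (Σ; _×_; _,_; proj₁; proj₂)
open import Data.Sum using (_⊎_; inj₁; inj₂)
open import Data.Unit using (tt)
import Data.Fin.Subset as Subset
open import Data.Fin.Subset.Properties using () renaming (_∈?_ to _∈Subset?_)
import Data.Vec as Vec
import Data.Vec.Properties as Vec
open import Data.Vec.Properties.WithK using ([]=-irrelevant)
open import Function using (_∘_; id; case_of_; mk⇔)
open import Relation.Binary.PropositionalEquality as ≡ using (_≡_; _≢_; refl; trans; cong; cong₂; subst)
open import Relation.Nullary using (Dec; yes; no; does; ¬_; contradiction)
open import Relation.Nullary.Decidable using (_×-dec_; _⊎-dec_; ¬?; map′; dec-true; dec-false; does-⇔; decidable-stable)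

-- Finite sums of natural numbers

private variable
  N k l : ℕ

sum-mono : {f g : Fin N → ℕ} → (∀ i → f i ≤ g i) → sum f ≤ sum g
sum-mono {zero}  f≤g = z≤n
sum-mono {suc N} f≤g = +-mono-≤ (f≤g zero) (sum-mono (f≤g ∘ suc))

sum-mono-strict : {f g : Fin N → ℕ} → (∀ i → f i ≤ g i) → ∀ i → f i < g i → sum f < sum g
sum-mono-strict f≤g zero    fi<gi = +-mono-<-≤ fi<gi (sum-mono (f≤g ∘ suc))
sum-mono-strict f≤g (suc i) fi<gi = +-mono-≤-< (f≤g zero) (sum-mono-strict (f≤g ∘ suc) i fi<gi)

term≤sum : (f : Fin N → ℕ) → ∀ i → f i ≤ sum f
term≤sum f zero    = m≤m+n _ _
term≤sum f (suc i) = ≤-trans (term≤sum (f ∘ suc) i) (m≤n+m _ _)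

sum-zero : {f : Fin N → ℕ} → (∀ i → f i ≡ 0) → sum f ≡ 0
sum-zero {zero}  f≡0 = refl
sum-zero {suc N} f≡0 = cong₂ _+_ (f≡0 zero) (sum-zero (f≡0 ∘ suc))

sum-one : ∀ N → ∑[ i < N ] 1 ≡ N
sum-one zero    = refl
sum-one (suc N) = cong suc (sum-one N)

listSum-allFin : (f : Fin N → ℕ) → listSum (map f (allFin N)) ≡ sum f
listSum-allFin f = trans (cong listSum (map-tabulate id f)) (go f)
  where
  go : (f : Fin N → ℕ) → listSum (tabulate f) ≡ sum f
  go {zero}  f = refl
  go {suc N} f = cong (f zero +_) (go (f ∘ suc))

b2n≤1 : ∀ b → b2n b ≤ 1
b2n≤1 true  = ≤-refl
b2n≤1 false = z≤n

b2n-mono : ∀ {b c} → (b ≡ true → c ≡ true) → b2n b ≤ b2n c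
b2n-mono {false} b⇒c = z≤n
b2n-mono {true}  b⇒c rewrite b⇒c refl = ≤-refl

does-true⇒ : {A : Set} (a? : Dec A) → does a? ≡ true → A
does-true⇒ (yes a) _ = a

-- Counting and enumerating Boolean subsets

count : (Fin N → Bool) → ℕ
count P = sum (b2n ∘ P)

sum-≟ : (v : Fin N) → ∑[ x < N ] b2n (does (x ≟ v)) ≡ 1
sum-≟ {suc N} zero    = cong suc (sum-zero {N} λ _ → refl)
sum-≟ {suc N} (suc v) = trans (sum-cong-≗ λ x → cong b2n (suc-≟ x)) (sum-≟ v)
  where
  suc-≟ : ∀ x → does (suc x ≟ suc v) ≡ does (x ≟ v)
  suc-≟ x with x ≟ v
  ... | yes _ = refl
  ... | no  _ = refl

_∈?_ : (x : Fin N) (xs : List (Fin N)) → Dec (x ∈ xs)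
_∈?_ = DecMembership._∈?_ _≟_

count-∈≤length : (vs : List (Fin N)) → count (λ x → does (x ∈? vs)) ≤ length vs
count-∈≤length {N} [] = ≤-reflexive (sum-zero {N} λ _ → refl)
count-∈≤length (v ∷ vs) = begin
  ∑[ x < _ ] b2n (does (x ∈? (v ∷ vs)))                                ≤⟨ sum-mono pointwise ⟩
  ∑[ x < _ ] (b2n (does (x ≟ v)) + b2n (does (x ∈? vs)))               ≡⟨ ∑-distrib-+ _ (λ x → b2n (does (x ∈? vs))) ⟩
  ∑[ x < _ ] b2n (does (x ≟ v)) + ∑[ x < _ ] b2n (does (x ∈? vs))      ≤⟨ +-mono-≤ (≤-reflexive (sum-≟ v)) (count-∈≤length vs) ⟩
  suc (length vs)                                                      ∎
  where
  open ≤-Reasoning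
  pointwise : ∀ x → b2n (does (x ∈? (v ∷ vs))) ≤ b2n (does (x ≟ v)) + b2n (does (x ∈? vs))
  pointwise x with x ≟ v
  ... | yes _ = ≤-trans (b2n≤1 _) (m≤m+n 1 _)
  ... | no  _ = ≤-refl

-- Turns a subset into an initial segment, so that it can be the vertex set of a `Graph`; `sum-elem`
-- carries degree sums back to weighted sums over `Fin N`.
record Enumeration (P : Fin N → Bool) : Set where
  field
    size           : ℕ
    elem           : Fin size → Fin N
    elem-injective : ∀ {i j} → elem i ≡ elem j → i ≡ j
    elem-P         : ∀ i → P (elem i) ≡ true
    sum-elem       : ∀ f → sum (f ∘ elem) ≡ ∑[ u < N ] (b2n (P u) * f u)

  size≡count : size ≡ count P
  size≡count = trans (≡.sym (sum-one size))
    (trans (sum-elem (λ _ → 1)) (sum-cong-≗ λ u → *-identityʳ (b2n (P u))))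

enumerate : (P : Fin N → Bool) → Enumeration P
enumerate {zero} P = record
  { size = 0 ; elem = λ () ; elem-injective = λ { {()} } ; elem-P = λ () ; sum-elem = λ f → refl }
enumerate {suc N} P with P zero in P0 | enumerate (P ∘ suc)
... | false | E = record
  { size = E.size ; elem = suc ∘ E.elem ; elem-injective = E.elem-injective ∘ suc-injective
  ; elem-P = E.elem-P
  ; sum-elem = λ f → cong₂ _+_ (cong (λ b → b2n b * f zero) (≡.sym P0)) (E.sum-elem (f ∘ suc)) }
  where module E = Enumeration E
... | true  | E = record
  { size = suc E.size ; elem = elem′ ; elem-injective = injective ; elem-P = elem′-P
  ; sum-elem = λ f → cong₂ _+_
      (trans (≡.sym (*-identityˡ (f zero))) (cong (λ b → b2n b * f zero) (≡.sym P0)))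
      (E.sum-elem (f ∘ suc)) }
  where
  module E = Enumeration E
  elem′ : Fin (suc E.size) → Fin (suc N)
  elem′ zero    = zero
  elem′ (suc i) = suc (E.elem i)
  injective : ∀ {i j} → elem′ i ≡ elem′ j → i ≡ j
  injective {zero}  {zero}  _  = refl
  injective {suc i} {suc j} eq = cong suc (E.elem-injective (suc-injective eq))
  elem′-P : ∀ i → P (elem′ i) ≡ true
  elem′-P zero    = P0
  elem′-P (suc i) = E.elem-P i

toList : (P : Fin N → Bool) → ∃[ xs ] (length xs ≡ count P × (∀ x → P x ≡ true → x ∈ xs))
toList {zero}  P = [] , refl , λ ()
toList {suc N} P with P zero in P0 | toList (P ∘ suc)
... | false | xs , len , complete = map suc xs , trans (length-map suc xs) len , λ
  { zero P0′ → contradiction (trans (≡.sym P0) P0′) λ ()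
  ; (suc x) Px → ∈-map⁺ suc (complete x Px) }
... | true  | xs , len , complete = zero ∷ map suc xs , cong suc (trans (length-map suc xs) len) , λ
  { zero _ → here refl
  ; (suc x) Px → there (∈-map⁺ suc (complete x Px)) }


-- Walks

Vertex : Graph → Set
Vertex G = Fin (n G)

module _ {G : Graph} where

  private variable
    P Q : Vertex G → Set
    u v w x y z : Vertex G

  walk-mono : k ≤ l → WalkIn G P k u v → WalkIn G P l u v
  walk-mono k≤l       here              = here
  walk-mono (s≤s k≤l) (step uw Pw walk) = step uw Pw (walk-mono k≤l walk)

  walk-map : (∀ {x} → P x → Q x) → WalkIn G P k u v → WalkIn G Q k u v
  walk-map P⇒Q here              = here
  walk-map P⇒Q (step uw Pw walk) = step uw (P⇒Q Pw) (walk-map P⇒Q walk)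

  walk-++ : WalkIn G P k u v → WalkIn G P l v w → WalkIn G P (k + l) u w
  walk-++ {k = k} here walk′      = walk-mono (m≤n+m _ k) walk′
  walk-++ (step uw Pw walk) walk′ = step uw Pw (walk-++ walk walk′)

  walk-snoc : WalkIn G P k u v → adj G v w ≡ true → P w → WalkIn G P (suc k) u w
  walk-snoc here              vw Pw = step vw Pw here
  walk-snoc (step ux Px walk) vw Pw = step ux Px (walk-snoc walk vw Pw)

  walk-reverse : P u → WalkIn G P k u v → WalkIn G P k v u
  walk-reverse Pu here              = here
  walk-reverse Pu (step uw Pw walk) = walk-snoc (walk-reverse Pw walk) (trans (sym G _ _) uw) Pu

  walk-end : WalkIn G P k u v → u ≡ v ⊎ P v
  walk-end here = inj₁ refl
  walk-end (step _ Pw walk) with walk-end walk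
  ... | inj₁ refl = inj₂ Pw
  ... | inj₂ Pv   = inj₂ Pv

  walk? : (∀ x → Dec (P x)) → ∀ k u v → Dec (WalkIn G P k u v)
  walk? P? zero u v = map′ (λ { refl → here }) (λ { here → refl }) (u ≟ v)
  walk? P? (suc k) u v = map′
    (λ { (inj₁ refl) → here ; (inj₂ (w , uw , Pw , walk)) → step uw Pw walk })
    (λ { here → inj₁ refl ; (step uw Pw walk) → inj₂ (_ , uw , Pw , walk) })
    (u ≟ v ⊎-dec any? λ w → adj G u w Bool.≟ true ×-dec P? w ×-dec walk? P? k w v)

  vertices : WalkIn G P k u v → List (Vertex G)
  vertices here                    = []
  vertices (step {w = w} _ _ walk) = w ∷ vertices walk

  length-vertices : (walk : WalkIn G P k u v) → length (vertices walk) ≤ k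
  length-vertices here            = z≤n
  length-vertices (step _ _ walk) = s≤s (length-vertices walk)

  vertices-P : (walk : WalkIn G P k u v) → x ∈ vertices walk → P x
  vertices-P (step _ Pw walk) (here refl) = Pw
  vertices-P (step _ Pw walk) (there x∈)  = vertices-P walk x∈

  end∈vertices : (walk : WalkIn G P k u v) → u ≡ v ⊎ v ∈ vertices walk
  end∈vertices here = inj₁ refl
  end∈vertices (step _ _ walk) with end∈vertices walk
  ... | inj₁ refl = inj₂ (here refl)
  ... | inj₂ v∈   = inj₂ (there v∈)

  walk-to-vertex : (walk : WalkIn G P k u v) → x ∈ vertices walk → WalkIn G (_∈ vertices walk) k u x
  walk-to-vertex (step uw _ walk) (here refl) = step uw (here refl) here
  walk-to-vertex (step uw _ walk) (there x∈)  =
    step uw (here refl) (walk-map there (walk-to-vertex walk x∈))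

  -- Every vertex of the walk is reached by a prefix of it. Hence the set of vertices reachable from
  -- `u` is a legitimate branch set of radius `k`.
  walk-in-reachable : WalkIn G P k u v → WalkIn G (WalkIn G P k u) k u v
  walk-in-reachable walk = go 0 here walk
    where
    go : ∀ j → WalkIn G P j u x → WalkIn G P l x v → WalkIn G (WalkIn G P (j + l) u) l x v
    go j walk here = here
    go {l = suc l} j walk (step {w = w} xw Pw walk′) rewrite +-suc j l =
      step xw (walk-mono (m≤m+n (suc j) l) walk⁺) (go (suc j) walk⁺ walk′)
      where walk⁺ = walk-snoc walk xw Pw

  -- Cuts the walk at its first visit to `X` after the start. The strict drop to `l` bounds the
  -- number of jumps through separators.
  walk-hits : (X : List (Vertex G)) → WalkIn G P k u v →
    WalkIn G (_∉ X) k u v ⊎ ∃[ x ] ∃[ l ] (x ∈ X × P x × l < k × WalkIn G P l x v)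
  walk-hits X here = inj₁ here
  walk-hits X (step {k = k} {w = w} uw Pw walk) with w ∈? X | walk-hits X walk
  ... | yes w∈X | _ = inj₂ (w , k , w∈X , Pw , ≤-refl , walk)
  ... | no  w∉X | inj₁ avoiding = inj₁ (step uw w∉X avoiding)
  ... | no  w∉X | inj₂ (x , l , x∈X , Px , l<k , walk′) = inj₂ (x , l , x∈X , Px , m<n⇒m<1+n l<k , walk′)

-- Shallow minors on vertex subsets

DepthMinorDensity : Graph → ℕ → ℕ → Set
DepthMinorDensity G ρ c = ∀ H → IsDepthMinor ρ H G → degSum H ≤ c * n H

-- A depth-ρ minor model in which the branch set Br u, for u in S, is centred at u itself.
record MinorModel (G : Graph) (ρ : ℕ) (S : Vertex G → Bool) (Br : Vertex G → Vertex G → Set) : Set where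
  field
    Br?      : ∀ u w → Dec (Br u w)
    self     : ∀ {u} → S u ≡ true → Br u u
    radius   : ∀ {u w} → S u ≡ true → Br u w → WalkIn G (Br u) ρ u w
    disjoint : ∀ {u v w} → S u ≡ true → S v ≡ true → Br u w → Br v w → u ≡ v

  Touch : Vertex G → Vertex G → Set
  Touch u v = u ≢ v × ∃[ a ] ∃[ b ] (Br u a × Br v b × adj G a b ≡ true)

  touch? : ∀ u v → Dec (Touch u v)
  touch? u v = ¬? (u ≟ v) ×-dec any? λ a → any? λ b → Br? u a ×-dec Br? v b ×-dec adj G a b Bool.≟ true

  Touch-sym : ∀ {u v} → Touch u v → Touch v u
  Touch-sym (u≢v , a , b , ua , vb , ab) = u≢v ∘ ≡.sym , b , a , vb , ua , trans (sym G b a) ab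

  edge : Vertex G → Vertex G → Bool
  edge u v = does (touch? u v)

  edge⇒Touch : ∀ {u v} → edge u v ≡ true → Touch u v
  edge⇒Touch {u} {v} = does-true⇒ (touch? u v)

  Touch⇒edge : ∀ {u v} → Touch u v → edge u v ≡ true
  Touch⇒edge {u} {v} = dec-true (touch? u v)

  -- The weight `b2n (S v)` restricts the sum to `S`, so that degrees of the minor can be handled
  -- without re-indexing.
  deg : Vertex G → ℕ
  deg u = ∑[ v < n G ] (b2n (S v) * b2n (edge u v))

  totalDeg : ℕ
  totalDeg = ∑[ u < n G ] (b2n (S u) * deg u)

  edge-sym : ∀ u v → edge u v ≡ edge v u
  edge-sym u v = does-⇔ (mk⇔ Touch-sym Touch-sym) (touch? u v) (touch? v u)

  edge-irrefl : ∀ u → edge u u ≡ false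
  edge-irrefl u = dec-false (touch? u u) (λ uu → proj₁ uu refl)

  private
    open Enumeration (enumerate S)

    minor : Graph
    minor = record
      { n = size ; adj = λ i j → edge (elem i) (elem j)
      ; sym = λ i j → edge-sym (elem i) (elem j) ; irrefl = λ i → edge-irrefl (elem i) }

    branch : Vertex G → Subset (n G)
    branch u = Vec.tabulate λ w → does (Br? u w)

    ∈branch⇒ : ∀ {u w} → w Subset.∈ branch u → Br u w
    ∈branch⇒ {u} {w} w∈ = does-true⇒ (Br? u w) (trans (≡.sym (Vec.lookup∘tabulate _ w)) (Vec.[]=⇒lookup w∈))

    ⇒∈branch : ∀ {u w} → Br u w → w Subset.∈ branch u
    ⇒∈branch {u} {w} uw = Vec.lookup⇒[]= w (branch u) (trans (Vec.lookup∘tabulate _ w) (dec-true (Br? u w) uw))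

    isMinor : IsDepthMinor ρ minor G
    isMinor = record
      { η        = branch ∘ elem
      ; centre   = elem
      ; centre∈  = λ i → ⇒∈branch (self (elem-P i))
      ; radius   = λ i v v∈ → walk-map ⇒∈branch (radius (elem-P i) (∈branch⇒ v∈))
      ; disjoint = λ i j v i≢j v∈i v∈j →
          i≢j (elem-injective (disjoint (elem-P i) (elem-P j) (∈branch⇒ v∈i) (∈branch⇒ v∈j)))
      ; edges    = λ i j ij → let _ , a , b , ia , jb , ab = edge⇒Touch ij in
          a , b , ⇒∈branch ia , ⇒∈branch jb , ab
      }

    degSum-minor : degSum minor ≡ totalDeg
    degSum-minor = begin
      degSum minor                ≡⟨ listSum-allFin (degree minor) ⟩
      ∑[ i < size ] degree minor i  ≡⟨ sum-cong-≗ degree-minor ⟩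
      ∑[ i < size ] deg (elem i)    ≡⟨ sum-elem deg ⟩
      totalDeg                    ∎
      where
      open ≡.≡-Reasoning
      degree-minor : ∀ i → degree minor i ≡ deg (elem i)
      degree-minor i =
        trans (listSum-allFin (λ j → b2n (adj minor i j))) (sum-elem (λ v → b2n (edge (elem i) v)))

  -- Contracting the branch sets and indexing them by `enumerate S` gives a depth-`ρ` minor with
  -- degree sum `totalDeg` and `count S` vertices.
  totalDeg≤ : ∀ c → DepthMinorDensity G ρ c → totalDeg ≤ c * count S
  totalDeg≤ c dense = ≡.subst₂ _≤_ degSum-minor (cong (c *_) size≡count) (dense minor isMinor)

-- Saturating a shallow minor by short joining walks

module Saturation (G : Graph) (S : Vertex G → Bool) (ρ : ℕ) where

  -- The branch set of u consists of the vertices labelled u.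
  record Labelling : Set where
    field
      label        : Vertex G → Maybe (Vertex G)
      label-self   : ∀ {u} → S u ≡ true → label u ≡ just u
      label-radius : ∀ {u w} → S u ≡ true → label w ≡ just u → WalkIn G (λ x → label x ≡ just u) ρ u w

    labelled : Vertex G → Bool
    labelled = is-just ∘ label

    model : MinorModel G ρ S (λ u w → label w ≡ just u)
    model = record
      { Br?      = λ u w → ≡-dec _≟_ (label w) (just u)
      ; self     = label-self
      ; radius   = label-radius
      ; disjoint = λ _ _ w∈u w∈v → just-injective (trans (≡.sym w∈u) w∈v)
      }

    open MinorModel model public

    -- Invariant of the joining process: each joining labels at most `ρ` new vertices and raises
    -- `totalDeg` by at least one.
    Small : Set
    Small = count labelled ≤ count S + ρ * totalDeg

    -- A possible joining: giving the label `u` to the walk from `u` to `z` makes `u` and `v` touch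
    -- through the edge `zb`.
    Violation : (u v z b : Vertex G) → Set
    Violation u v z b = S u ≡ true × S v ≡ true × u ≢ v × WalkIn G (λ x → label x ≡ nothing) ρ u z
      × adj G z b ≡ true × label b ≡ just v × ¬ Touch u v

    violation? : ∀ u v z b → Dec (Violation u v z b)
    violation? u v z b = S u Bool.≟ true ×-dec S v Bool.≟ true ×-dec ¬? (u ≟ v)
      ×-dec walk? (λ x → ≡-dec _≟_ (label x) nothing) ρ u z
      ×-dec adj G z b Bool.≟ true ×-dec ≡-dec _≟_ (label b) (just v) ×-dec ¬? (touch? u v)

    Saturated : Set
    Saturated = ∀ {u v z b} → ¬ Violation u v z b

  open Labelling using (Small; Saturated; Violation; violation?; totalDeg)

  initial : Σ Labelling Small
  initial = L , ≤-trans (≤-reflexive (sum-cong-≗ labelled≡S)) (m≤m+n _ _)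
    where
    label : Vertex G → Maybe (Vertex G)
    label u = if S u then just u else nothing

    label-self : ∀ {u} → S u ≡ true → label u ≡ just u
    label-self Su rewrite Su = refl

    label⇒≡ : ∀ {u} w → label w ≡ just u → w ≡ u
    label⇒≡ w eq with S w
    label⇒≡ w refl | true = refl

    L : Labelling
    L = record
      { label        = label
      ; label-self   = label-self
      ; label-radius = λ { {w = w} _ eq → case label⇒≡ w eq of λ { refl → here } }
      }

    labelled≡S : ∀ u → b2n (is-just (label u)) ≡ b2n (S u)
    labelled≡S u with S u
    ... | true  = refl
    ... | false = refl

  module Extend (L : Labelling) {u v z b} (violation : Violation L u v z b) where
    open Labelling L hiding (Small; Saturated; Violation; violation?; totalDeg)

    private
      Su    = proj₁ violation
      Sv    = proj₁ (proj₂ violation)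
      u≢v   = proj₁ (proj₂ (proj₂ violation))
      walk  = proj₁ (proj₂ (proj₂ (proj₂ violation)))
      zb    = proj₁ (proj₂ (proj₂ (proj₂ (proj₂ violation))))
      b∈v   = proj₁ (proj₂ (proj₂ (proj₂ (proj₂ (proj₂ violation)))))
      ¬uv   = proj₂ (proj₂ (proj₂ (proj₂ (proj₂ (proj₂ violation)))))

      label′ : Vertex G → Maybe (Vertex G)
      label′ x = if does (x ∈? vertices walk) then just u else label x

      label′-new : ∀ {x} → x ∈ vertices walk → label′ x ≡ just u
      label′-new {x} x∈ rewrite dec-true (x ∈? vertices walk) x∈ = refl

      label′-old : ∀ {x y} → label x ≡ just y → label′ x ≡ just y
      label′-old {x} x∈y with x ∈? vertices walk
      ... | no  _  = x∈y
      ... | yes x∈ = contradiction (trans (≡.sym x∈y) (vertices-P walk x∈)) λ ()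

      -- Old vertices keep their walks. A new vertex is reached along the joining walk, which starts
      -- at the centre `u` itself, so the radius does not accumulate over several joinings.
      label′-radius : ∀ {y x} → S y ≡ true → label′ x ≡ just y → WalkIn G (λ t → label′ t ≡ just y) ρ y x
      label′-radius {x = x} Sy eq with x ∈? vertices walk
      ... | no  _ = walk-map label′-old (label-radius Sy eq)
      label′-radius {x = x} Sy refl | yes x∈ = walk-map label′-new (walk-to-vertex walk x∈)

    L′ : Labelling
    L′ = record
      { label = label′ ; label-self = label′-old ∘ label-self ; label-radius = label′-radius }

    private
      module L′ = Labelling L′

      Touch⇒Touch′ : ∀ {x y} → Touch x y → L′.Touch x y
      Touch⇒Touch′ (x≢y , a , b , xa , yb , ab) = x≢y , a , b , label′-old xa , label′-old yb , ab

      touch-uv : L′.Touch u v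
      touch-uv = u≢v , z , b , z∈u , label′-old b∈v , zb
        where
        z∈u : label′ z ≡ just u
        z∈u with end∈vertices walk
        ... | inj₁ refl = label′-old (label-self Su)
        ... | inj₂ z∈   = label′-new z∈

      term-mono : ∀ x y → b2n (S y) * b2n (edge x y) ≤ b2n (S y) * b2n (L′.edge x y)
      term-mono x y = *-monoʳ-≤ (b2n (S y)) (b2n-mono (L′.Touch⇒edge ∘ Touch⇒Touch′ ∘ edge⇒Touch {x} {y}))

      deg-increases : deg u < L′.deg u
      deg-increases = sum-mono-strict (term-mono u) v term-increases
        where
        term-increases : b2n (S v) * b2n (edge u v) < b2n (S v) * b2n (L′.edge u v)
        term-increases rewrite Sv | dec-false (touch? u v) ¬uv | L′.Touch⇒edge touch-uv = ≤-refl

    totalDeg-increases : totalDeg L < totalDeg L′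
    totalDeg-increases = sum-mono-strict (λ x → *-monoʳ-≤ (b2n (S x)) (sum-mono (term-mono x))) u term-increases
      where
      term-increases : b2n (S u) * deg u < b2n (S u) * L′.deg u
      term-increases rewrite Su = +-monoˡ-< 0 deg-increases

    small : Small L → Small L′
    small smallL = begin
      count L′.labelled                            ≤⟨ sum-mono pointwise ⟩
      ∑[ x < n G ] (b2n (labelled x) + b2n (does (x ∈? vertices walk)))
                                                   ≡⟨ ∑-distrib-+ (b2n ∘ labelled) _ ⟩
      count labelled + count (λ x → does (x ∈? vertices walk))
        ≤⟨ +-mono-≤ smallL (≤-trans (count-∈≤length (vertices walk)) (length-vertices walk)) ⟩
      count S + ρ * totalDeg L + ρ                 ≡⟨ +-assoc (count S) _ ρ ⟩
      count S + (ρ * totalDeg L + ρ)               ≡⟨ cong (count S +_) (+-comm _ ρ) ⟩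
      count S + (ρ + ρ * totalDeg L)               ≡⟨ cong (count S +_) (*-suc ρ _) ⟨
      count S + ρ * suc (totalDeg L)               ≤⟨ +-monoʳ-≤ (count S) (*-monoʳ-≤ ρ totalDeg-increases) ⟩
      count S + ρ * totalDeg L′                    ∎
      where
      open ≤-Reasoning
      pointwise : ∀ x → b2n (L′.labelled x) ≤ b2n (labelled x) + b2n (does (x ∈? vertices walk))
      pointwise x with x ∈? vertices walk
      ... | yes _ = m≤n+m 1 _
      ... | no  _ = m≤m+n _ 0

  -- Joining must stop, since `totalDeg` grows each time and the density hypothesis caps it at
  -- `c * count S`; the fuel measures the remaining room.
  saturate : ∀ c → DepthMinorDensity G ρ c → ∃[ L ] (Saturated L × Small L)
  saturate c dense = go (suc (c * count S)) (proj₁ initial) (proj₂ initial) (m≤n+m _ _)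
    where
    go : ∀ fuel L → Small L → c * count S < totalDeg L + fuel → ∃[ L ] (Saturated L × Small L)
    go zero L _ bound = contradiction
      (≤-trans bound (≤-trans (≤-reflexive (+-identityʳ _)) (Labelling.totalDeg≤ L c dense))) (<-irrefl refl)
    go (suc fuel) L smallL bound
      with any? (λ u → any? λ v → any? λ z → any? λ b → violation? L u v z b)
    ... | no ¬violation = L , (λ {u} {v} {z} {b} viol → ¬violation (u , v , z , b , viol)) , smallL
    ... | yes (u , v , z , b , viol) = go fuel L′ (small smallL)
      (≤-trans bound (≤-trans (≤-reflexive (+-suc (totalDeg L) fuel)) (+-monoˡ-≤ fuel totalDeg-increases)))
      where open Extend L viol

-- Large independent sets in sparse minors

b2n-∧ : ∀ a b → b2n (a ∧ b) ≡ b2n a * b2n b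
b2n-∧ true  b = ≡.sym (+-identityʳ (b2n b))
b2n-∧ false b = refl

count-pos : (P : Fin N → Bool) {u : Fin N} → P u ≡ true → 0 < count P
count-pos P {u} Pu = ≤-trans (≤-reflexive (cong b2n (≡.sym Pu))) (term≤sum (b2n ∘ P) u)

Independent : (Fin N → Fin N → Bool) → (Fin N → Bool) → Set
Independent E I = ∀ {u v} → I u ≡ true → I v ≡ true → u ≢ v → E u v ≡ false

Dominated : (Fin N → Fin N → Bool) → (Fin N → Bool) → Fin N → Set
Dominated E I u = ∃[ v ] (I v ≡ true × (u ≡ v ⊎ E v u ≡ true))

-- Greedy scan: a vertex of `L` is added unless the current set dominates it. The set only grows, so
-- domination persists.
maximalIndependent : (E : Fin N → Fin N → Bool) → (∀ u v → E u v ≡ E v u) → (L : Fin N → Bool) →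
  ∃[ I ] ((∀ {u} → I u ≡ true → L u ≡ true) × Independent E I × (∀ {u} → L u ≡ true → Dominated E I u))
maximalIndependent {N} E E-sym L with go (allFin N)
  where
  go : (vs : List (Fin N)) →
    ∃[ I ] ((∀ {u} → I u ≡ true → L u ≡ true) × Independent E I × (∀ {u} → u ∈ vs → L u ≡ true → Dominated E I u))
  go [] = (λ _ → false) , (λ ()) , (λ ()) , λ ()
  go (v ∷ vs) with go vs
  ... | I , I⊆L , indep , dom with L v in Lv | any? (λ w → I w Bool.≟ true ×-dec (v ≟ w ⊎-dec E w v Bool.≟ true))
  ... | false | _ = I , I⊆L , indep , λ
    { (here refl) Lv′ → contradiction (trans (≡.sym Lv) Lv′) λ () ; (there u∈) → dom u∈ }
  ... | true | yes dominated = I , I⊆L , indep , λ { (here refl) _ → dominated ; (there u∈) → dom u∈ }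
  ... | true | no ¬dominated = I′ , I′⊆L , indep′ , λ
    { (here refl) _ → v , I′v , inj₁ refl
    ; (there u∈) Lu → let w , Iw , uw = dom u∈ Lu in w , I⊆I′ Iw , uw }
    where
    I′ : Fin N → Bool
    I′ x = does (x ≟ v) ∨ I x

    I′v : I′ v ≡ true
    I′v rewrite dec-true (v ≟ v) refl = refl

    I⊆I′ : ∀ {x} → I x ≡ true → I′ x ≡ true
    I⊆I′ {x} Ix rewrite Ix = Bool.∨-zeroʳ (does (x ≟ v))

    I′⇒ : ∀ x → I′ x ≡ true → x ≡ v ⊎ I x ≡ true
    I′⇒ x I′x with x ≟ v
    ... | yes x≡v = inj₁ x≡v
    ... | no  _   = inj₂ I′x

    I′⊆L : ∀ {x} → I′ x ≡ true → L x ≡ true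
    I′⊆L {x} I′x with I′⇒ x I′x
    ... | inj₁ refl = Lv
    ... | inj₂ Ix   = I⊆L Ix

    nonadjacent : ∀ {w} → I w ≡ true → E w v ≡ false
    nonadjacent {w} Iw with E w v in wv
    ... | false = refl
    ... | true  = contradiction (w , Iw , inj₂ wv) ¬dominated

    indep′ : Independent E I′
    indep′ {x} {y} I′x I′y x≢y with I′⇒ x I′x | I′⇒ y I′y
    ... | inj₁ refl | inj₁ refl = contradiction refl x≢y
    ... | inj₁ refl | inj₂ Iy   = trans (E-sym v y) (nonadjacent Iy)
    ... | inj₂ Ix   | inj₁ refl = nonadjacent Ix
    ... | inj₂ Ix   | inj₂ Iy   = indep Ix Iy x≢y
... | I , I⊆L , indep , dom = I , I⊆L , indep , λ {u} → dom (∈-allFin u)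

module _ {G ρ S Br} (model : MinorModel G ρ S Br) (c : ℕ) (dense : DepthMinorDensity G ρ c) where
  open MinorModel model

  private
    low : Vertex G → Bool
    low u = S u ∧ does (deg u ≤? c)

    low⇒S : ∀ {u} → low u ≡ true → S u ≡ true
    low⇒S {u} low-u with S u
    ... | true = refl

    low⇒deg≤ : ∀ {u} → low u ≡ true → deg u ≤ c
    low⇒deg≤ {u} low-u with S u
    ... | true = does-true⇒ (deg u ≤? c) low-u

    -- Markov's inequality: each vertex of `S` that is not low contributes at least `suc c` to
    -- `totalDeg`, which is at most `c * count S`.
    count-S≤ : count S ≤ suc c * count low
    count-S≤ = +-cancelʳ-≤ (c * count S) _ _ (begin
      suc c * count S                            ≡⟨ *-distribˡ-sum (suc c) (b2n ∘ S) ⟩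
      ∑[ u < n G ] (suc c * b2n (S u))             ≤⟨ sum-mono (λ u → pointwise (S u) (deg u ≤? c)) ⟩
      ∑[ u < n G ] (suc c * b2n (low u) + b2n (S u) * deg u)
        ≡⟨ ∑-distrib-+ (λ u → suc c * b2n (low u)) (λ u → b2n (S u) * deg u) ⟩
      ∑[ u < n G ] (suc c * b2n (low u)) + totalDeg ≡⟨ cong (_+ totalDeg) (*-distribˡ-sum (suc c) (b2n ∘ low)) ⟨
      suc c * count low + totalDeg               ≤⟨ +-monoʳ-≤ (suc c * count low) (totalDeg≤ c dense) ⟩
      suc c * count low + c * count S            ∎)
      where
      open ≤-Reasoning
      pointwise : ∀ s {D} (D≤c? : Dec (D ≤ c)) → suc c * b2n s ≤ suc c * b2n (s ∧ does D≤c?) + b2n s * D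
      pointwise false _       = ≤-reflexive (≡.sym (+-identityʳ _))
      pointwise true  (yes _) = m≤m+n _ _
      pointwise true {D} (no D≰c) = begin
        suc c * 1           ≡⟨ *-identityʳ (suc c) ⟩
        suc c               ≤⟨ ≰⇒> D≰c ⟩
        D                   ≡⟨ *-identityˡ D ⟨
        1 * D               ≤⟨ m≤n+m _ (suc c * 0) ⟩
        suc c * 0 + 1 * D   ∎

    module _ {I : Vertex G → Bool} (I⊆low : ∀ {u} → I u ≡ true → low u ≡ true)
             (dominated : ∀ {u} → low u ≡ true → Dominated edge I u) where

      -- Double counting: every low vertex is covered by some `v` in `I`, and such a `v` covers
      -- itself and its at most `c` neighbours.
      count-low≤ : count low ≤ suc c * count I
      count-low≤ = begin
        ∑[ u < n G ] b2n (low u)                         ≤⟨ sum-mono covered ⟩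
        ∑[ u < n G ] ∑[ v < n G ] cover u v              ≡⟨ ∑-comm cover ⟩
        ∑[ v < n G ] ∑[ u < n G ] cover u v              ≤⟨ sum-mono cover-≤ ⟩
        ∑[ v < n G ] (suc c * b2n (I v))                 ≡⟨ *-distribˡ-sum (suc c) (b2n ∘ I) ⟨
        suc c * count I                                  ∎
        where
        open ≤-Reasoning
        cover : Vertex G → Vertex G → ℕ
        cover u v = b2n (I v) * (b2n (does (u ≟ v)) + b2n (S u) * b2n (edge v u))

        covered : ∀ u → b2n (low u) ≤ ∑[ v < n G ] cover u v
        covered u with low u in low-u
        ... | false = z≤n
        ... | true with dominated low-u
        ... | v , Iv , near = ≤-trans (1≤cover near) (term≤sum (cover u) v)
          where
          1≤cover : u ≡ v ⊎ edge v u ≡ true → 1 ≤ cover u v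
          1≤cover (inj₁ refl) rewrite Iv | dec-true (u ≟ u) refl = s≤s z≤n
          1≤cover (inj₂ vu) rewrite Iv | low⇒S {u} low-u | vu =
            ≤-trans (m≤n+m 1 (b2n (does (u ≟ v)))) (m≤m+n _ 0)

        cover-≤ : ∀ v → ∑[ u < n G ] cover u v ≤ suc c * b2n (I v)
        cover-≤ v = begin
          ∑[ u < n G ] cover u v
            ≡⟨ *-distribˡ-sum (b2n (I v)) (λ u → b2n (does (u ≟ v)) + b2n (S u) * b2n (edge v u)) ⟨
          b2n (I v) * ∑[ u < n G ] (b2n (does (u ≟ v)) + b2n (S u) * b2n (edge v u))
            ≡⟨ cong (b2n (I v) *_) (∑-distrib-+ (λ u → b2n (does (u ≟ v))) (λ u → b2n (S u) * b2n (edge v u))) ⟩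
          b2n (I v) * (∑[ u < n G ] b2n (does (u ≟ v)) + deg v)
            ≡⟨ cong (λ t → b2n (I v) * (t + deg v)) (sum-≟ v) ⟩
          b2n (I v) * suc (deg v)
            ≤⟨ deg-bound ⟩
          b2n (I v) * suc c
            ≡⟨ *-comm (b2n (I v)) (suc c) ⟩
          suc c * b2n (I v) ∎
          where
          deg-bound : b2n (I v) * suc (deg v) ≤ b2n (I v) * suc c
          deg-bound with I v in Iv
          ... | false = z≤n
          ... | true  = *-monoʳ-≤ 1 (s≤s (low⇒deg≤ (I⊆low Iv)))

  largeIndependent : ∃[ I ] ((∀ {u} → I u ≡ true → S u ≡ true) × Independent edge I
    × count S ≤ suc c * (suc c * count I))
  largeIndependent with maximalIndependent edge edge-sym low
  ... | I , I⊆low , indep , dominated = I , low⇒S ∘ I⊆low , indep ,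
    ≤-trans count-S≤ (*-monoʳ-≤ (suc c) (count-low≤ I⊆low dominated))

-- Separators and generalised colouring numbers

-- Only vertices after the start must avoid `X`: the start `v` is exempt, while an endpoint `u` in
-- `X` counts as separated.
Separates : (G : Graph) → ℕ → (Vertex G → Set) → Vertex G → List (Vertex G) → Set
Separates G r S v X = ∀ {u} → S u → u ≢ v → ¬ WalkIn G (_∉ X) r v u

-- Average degree over `I` in the second minor: the density `c′`, times the ratio of labelled
-- vertices to `S`, times the ratio of `S` to `I`.
separatorSize : (r c c′ : ℕ) → ℕ
separatorSize r c c′ = c′ * (suc ((r + r) * c) * (suc c * suc c))

module _ {G : Graph} {r c c′ : ℕ}
         (dense : DepthMinorDensity G (r + r) c) (dense′ : DepthMinorDensity G r c′) where

  module _ (S : Vertex G → Bool) where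
    -- Two regions of radius `r` that meet yield a joining walk of length at most `r + r`.
    open Saturation G S (r + r)

    module _ (L : Labelling) (saturated : Labelling.Saturated L) (small : Labelling.Small L)
             {I : Vertex G → Bool} (I⊆S : ∀ {u} → I u ≡ true → S u ≡ true)
             (independent : Independent (Labelling.edge L) I)
             (count-S≤ : count S ≤ suc c * (suc c * count I)) where
      open Labelling L hiding (Small; Saturated)

      private
        Unlabelled : Vertex G → Set
        Unlabelled x = label x ≡ nothing

        S⇒labelled : ∀ {u} → S u ≡ true → labelled u ≡ true
        S⇒labelled Su = cong is-just (label-self Su)

        labelled⇒¬Unlabelled : ∀ {u} → labelled u ≡ true → ¬ Unlabelled u
        labelled⇒¬Unlabelled labelled-u unlabelled = contradiction (trans (≡.sym labelled-u) (cong is-just unlabelled)) λ ()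

        ¬Touch : ∀ {u v} → I u ≡ true → I v ≡ true → u ≢ v → ¬ Touch u v
        ¬Touch Iu Iv u≢v uv = contradiction (trans (≡.sym (Touch⇒edge uv)) (independent Iu Iv u≢v)) λ ()

        -- The walk from `u` to `w` is continued backwards along the walk from `x` to `w`. Stepping
        -- onto `v` would give a violation, since elements of `I` do not touch. For `x = v` the
        -- conclusion contradicts `v` being labelled, so the regions of `u` and `v` cannot meet.
        prolong : ∀ {u v w x} → I u ≡ true → I v ≡ true → u ≢ v →
          WalkIn G Unlabelled k u w → Unlabelled w →
          Unlabelled x ⊎ x ≡ v → WalkIn G Unlabelled l x w → k + l ≤ r + r →
          Unlabelled x × WalkIn G Unlabelled (k + l) u x
        prolong Iu Iv u≢v uw unl-w x-ok here _ = unl-w , walk-mono (m≤m+n _ _) uw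
        prolong {k = k} {l = suc l} Iu Iv u≢v uw unl-w x-ok (step {w = z} xz unl-z zw) bound
          rewrite +-suc k l
          with prolong Iu Iv u≢v uw unl-w (inj₁ unl-z) zw (<⇒≤ bound) | x-ok
        ... | _ , uz | inj₁ unl-x = unl-x , walk-snoc uz (trans (sym G _ _) xz) unl-x
        ... | _ , uz | inj₂ refl  = ⊥-elim (saturated
          ( I⊆S Iu , I⊆S Iv , u≢v , walk-mono (<⇒≤ bound) uz , trans (sym G _ _) xz
          , label-self (I⊆S Iv) , ¬Touch Iu Iv u≢v ))

        -- A second minor, on all labelled vertices: elements of `I` absorb their unlabelled regions
        -- of radius `r`, the other labelled vertices stay singletons.
        Br′ : Vertex G → Vertex G → Set
        Br′ u w = u ≡ w ⊎ (I u ≡ true × WalkIn G Unlabelled r u w)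

        unlabelled? : ∀ x → Dec (Unlabelled x)
        unlabelled? x = ≡-dec _≟_ (label x) nothing

        singleton-disjoint : ∀ {u v} → labelled u ≡ true → WalkIn G Unlabelled r v u → u ≡ v
        singleton-disjoint labelled-u walk with walk-end walk
        ... | inj₁ v≡u = ≡.sym v≡u
        ... | inj₂ unl = contradiction unl (labelled⇒¬Unlabelled labelled-u)

        disjoint′ : ∀ {u v w} → labelled u ≡ true → labelled v ≡ true → Br′ u w → Br′ v w → u ≡ v
        disjoint′ lu lv (inj₁ refl)     (inj₁ refl)     = refl
        disjoint′ lu lv (inj₁ refl)     (inj₂ (Iv , q)) = singleton-disjoint lu q
        disjoint′ lu lv (inj₂ (Iu , p)) (inj₁ refl)     = ≡.sym (singleton-disjoint lv p)
        disjoint′ {u} {v} lu lv (inj₂ (Iu , p)) (inj₂ (Iv , q)) with u ≟ v | walk-end p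
        ... | yes u≡v | _         = u≡v
        ... | no _    | inj₁ refl = singleton-disjoint lu q
        ... | no u≢v  | inj₂ unl  = ⊥-elim (labelled⇒¬Unlabelled lv
          (proj₁ (prolong Iu Iv u≢v p unl (inj₂ refl) q ≤-refl)))

        model′ : MinorModel G r labelled Br′
        model′ = record
          { Br?      = λ u w → u ≟ w ⊎-dec (I u Bool.≟ true ×-dec walk? unlabelled? r u w)
          ; self     = λ _ → inj₁ refl
          ; radius   = λ { _ (inj₁ refl) → here
                         ; _ (inj₂ (Iu , walk)) → walk-map (λ p → inj₂ (Iu , p)) (walk-in-reachable walk) }
          ; disjoint = disjoint′
          }

        module M = MinorModel model′

      -- `X` consists of the neighbours of `v` in the second minor. A short walk from `v` remains in
      -- the branch set of `v` until its first labelled vertex other than `v`, which is then such a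
      -- neighbour; elements of `S` are labelled.
      separator-at : ∀ {v} → I v ≡ true → M.deg v ≤ l →
        ∃[ X ] (length X ≤ l × Separates G r (λ u → S u ≡ true) v X)
      separator-at {v = v} Iv deg≤ = X , length-X , λ Su u≢v → escape u≢v (S⇒labelled Su) here ≤-refl
        where
        neighbour : Vertex G → Bool
        neighbour x = labelled x ∧ M.edge v x

        X = proj₁ (toList neighbour)

        length-X : length X ≤ _
        length-X = ≤-trans (≤-reflexive (trans (proj₁ (proj₂ (toList neighbour)))
          (sum-cong-≗ λ x → b2n-∧ (labelled x) (M.edge v x)))) deg≤

        escape : ∀ {u x j k} → u ≢ v → labelled u ≡ true → WalkIn G Unlabelled j v x → j + k ≤ r →
          ¬ WalkIn G (_∉ X) k x u
        escape u≢v lu vx bound here =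
          u≢v (singleton-disjoint lu (walk-mono (m+n≤o⇒m≤o _ bound) vx))
        escape {x = x} {j} {suc k} u≢v lu vx bound (step {w = z} xz z∉X zu)
          with z ≟ v | label z in label-z
        -- The walk has returned to `v`, which is labelled, so the unlabelled part restarts with
        -- length 0.
        ... | yes refl | _ = escape u≢v lu here
          (≤-trans (m≤n+m k (suc j)) (≤-trans (≤-reflexive (≡.sym (+-suc j k))) bound)) zu
        ... | no _     | nothing = escape u≢v lu (walk-snoc vx xz label-z)
          (≤-trans (≤-reflexive (≡.sym (+-suc j k))) bound) zu
        ... | no z≢v   | just _ = z∉X (proj₂ (proj₂ (toList neighbour)) z
          (cong₂ _∧_ (cong is-just label-z) (M.Touch⇒edge
            (z≢v ∘ ≡.sym , x , z , inj₂ (Iv , walk-mono (m+n≤o⇒m≤o _ bound) vx) , inj₁ refl , xz))))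

      private
        ℓ = separatorSize r c c′

        count-labelled≤ : count labelled ≤ suc ((r + r) * c) * count S
        count-labelled≤ = begin
          count labelled                           ≤⟨ small ⟩
          count S + (r + r) * totalDeg             ≤⟨ +-monoʳ-≤ (count S) (*-monoʳ-≤ (r + r) (totalDeg≤ c dense)) ⟩
          count S + (r + r) * (c * count S)        ≡⟨ cong (count S +_) (*-assoc (r + r) c (count S)) ⟨
          count S + (r + r) * c * count S          ∎
          where open ≤-Reasoning

        totalDeg′≤ : M.totalDeg ≤ ℓ * count I
        totalDeg′≤ = begin
          M.totalDeg                                               ≤⟨ M.totalDeg≤ c′ dense′ ⟩
          c′ * count labelled                                      ≤⟨ *-monoʳ-≤ c′ count-labelled≤ ⟩
          c′ * (K * count S)                                       ≤⟨ *-monoʳ-≤ c′ (*-monoʳ-≤ K count-S≤) ⟩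
          c′ * (K * (suc c * (suc c * count I)))                   ≡⟨ cong (λ t → c′ * (K * t)) (*-assoc (suc c) (suc c) (count I)) ⟨
          c′ * (K * (suc c * suc c * count I))                     ≡⟨ cong (c′ *_) (*-assoc K (suc c * suc c) (count I)) ⟨
          c′ * (K * (suc c * suc c) * count I)                     ≡⟨ *-assoc c′ (K * (suc c * suc c)) (count I) ⟨
          ℓ * count I                                              ∎
          where
          open ≤-Reasoning
          K = suc ((r + r) * c)

        -- Averaging: if all degrees over `I` exceeded `ℓ`, then `totalDeg′≤` would force `I`, and
        -- with it `S`, to be empty.
        low-degree : 0 < count S → ∃[ v ] (I v ≡ true × M.deg v ≤ ℓ)
        low-degree 0<S with any? (λ v → I v Bool.≟ true ×-dec M.deg v ≤? ℓ)
        ... | yes found = found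
        ... | no ¬found = contradiction 0<S (≤⇒≯ (≤-trans count-S≤ (≤-reflexive S≡0)))
          where
          high : ∀ v → suc ℓ * b2n (I v) ≤ b2n (labelled v) * M.deg v
          high v = by-cases (I v) refl
            where
            open ≤-Reasoning
            by-cases : ∀ b → I v ≡ b → suc ℓ * b2n b ≤ b2n (labelled v) * M.deg v
            by-cases false _  = ≤-trans (≤-reflexive (*-zeroʳ (suc ℓ))) z≤n
            by-cases true  Iv = begin
              suc ℓ * 1                      ≡⟨ *-identityʳ (suc ℓ) ⟩
              suc ℓ                          ≤⟨ ≰⇒> (λ deg≤ → ¬found (v , Iv , deg≤)) ⟩
              M.deg v                        ≡⟨ *-identityˡ (M.deg v) ⟨
              1 * M.deg v                    ≡⟨ cong (λ b → b2n b * M.deg v) (S⇒labelled (I⊆S Iv)) ⟨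
              b2n (labelled v) * M.deg v     ∎

          I≤0 : count I ≤ 0
          I≤0 = +-cancelʳ-≤ (ℓ * count I) (count I) 0 (begin
            suc ℓ * count I                             ≡⟨ *-distribˡ-sum (suc ℓ) (b2n ∘ I) ⟩
            ∑[ v < n G ] (suc ℓ * b2n (I v))            ≤⟨ sum-mono high ⟩
            M.totalDeg                                  ≤⟨ totalDeg′≤ ⟩
            ℓ * count I                                 ∎)
            where open ≤-Reasoning

          S≡0 : suc c * (suc c * count I) ≡ 0
          S≡0 rewrite n≤0⇒n≡0 I≤0 | *-zeroʳ (suc c) = *-zeroʳ (suc c)

      separator-from : 0 < count S → ∃[ v ] ∃[ X ]
        (S v ≡ true × length X ≤ ℓ × Separates G r (λ u → S u ≡ true) v X)
      separator-from 0<S with low-degree 0<S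
      ... | v , Iv , deg≤ with separator-at Iv deg≤
      ... | X , X≤ , sep = v , X , I⊆S Iv , X≤ , sep

    separator : 0 < count S → ∃[ v ] ∃[ X ]
      (S v ≡ true × length X ≤ separatorSize r c c′ × Separates G r (λ u → S u ≡ true) v X)
    separator 0<S with saturate c dense
    ... | L , saturated , small with largeIndependent (Labelling.model L) c dense
    ... | I , I⊆S , indep , S≤ = separator-from L saturated small I⊆S indep S≤ 0<S

-- Linear orders by successive removal

record SeparatorOrder (G : Graph) (r ℓ : ℕ) (S : Vertex G → Bool) (size : ℕ) : Set where
  field
    pos           : Vertex G → ℕ
    pos<size      : ∀ {v} → S v ≡ true → pos v < size
    pos-injective : ∀ {u v} → S u ≡ true → S v ≡ true → pos u ≡ pos v → u ≡ v
    sep           : Vertex G → List (Vertex G)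
    length-sep    : ∀ {v} → S v ≡ true → length (sep v) ≤ ℓ
    separates     : ∀ {v} → S v ≡ true → Separates G r (λ u → S u ≡ true × pos u < pos v) v (sep v)

-- The separable vertex `v` becomes the largest, at position `k`, and the rest is ordered
-- recursively. The vertices below `v` are then the rest of `S`, from which `X` separates it.
separatorOrder : {G : Graph} {r ℓ : ℕ} →
  (∀ S → 0 < count S → ∃[ v ] ∃[ X ] (S v ≡ true × length X ≤ ℓ × Separates G r (λ u → S u ≡ true) v X)) →
  ∀ k S → count S ≡ k → SeparatorOrder G r ℓ S k
separatorOrder separator zero S count≡0 = record
  { pos = λ _ → 0 ; pos<size = ⊥-elim ∘ empty ; pos-injective = λ Su → ⊥-elim (empty Su)
  ; sep = λ _ → [] ; length-sep = λ _ → z≤n ; separates = ⊥-elim ∘ empty }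
  where
  empty : ∀ {v} → S v ≡ true → ⊥
  empty Sv = contradiction (count-pos S Sv) (≤⇒≯ (≤-reflexive count≡0))
separatorOrder {G} {r} {ℓ} separator (suc k) S count≡1+k
  with separator S (≤-trans (s≤s z≤n) (≤-reflexive (≡.sym count≡1+k)))
... | v , X , Sv , X≤ , X-separates = record
  { pos = pos′ ; pos<size = pos′<size ; pos-injective = pos′-injective
  ; sep = sep′ ; length-sep = length-sep′ ; separates = separates′ }
  where
  S⁻ : Vertex G → Bool
  S⁻ x = not (does (x ≟ v)) ∧ S x

  S⁻-intro : ∀ {x} → S x ≡ true → x ≢ v → S⁻ x ≡ true
  S⁻-intro {x} Sx x≢v rewrite dec-false (x ≟ v) x≢v = Sx

  count-S⁻ : count S⁻ ≡ k
  count-S⁻ = +-cancelˡ-≡ 1 _ _ (begin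
    1 + count S⁻                                                  ≡⟨ cong (_+ count S⁻) (sum-≟ v) ⟨
    ∑[ x < n G ] b2n (does (x ≟ v)) + count S⁻                    ≡⟨ ∑-distrib-+ (λ x → b2n (does (x ≟ v))) (b2n ∘ S⁻) ⟨
    ∑[ x < n G ] (b2n (does (x ≟ v)) + b2n (S⁻ x))                ≡⟨ sum-cong-≗ pointwise ⟩
    count S                                                       ≡⟨ count≡1+k ⟩
    suc k                                                         ∎)
    where
    open ≡.≡-Reasoning
    pointwise : ∀ x → b2n (does (x ≟ v)) + b2n (S⁻ x) ≡ b2n (S x)
    pointwise x with x ≟ v
    ... | yes refl = cong b2n (≡.sym Sv)
    ... | no _     = refl

  open SeparatorOrder (separatorOrder separator k S⁻ count-S⁻)

  pos′ : Vertex G → ℕ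
  pos′ x = if does (x ≟ v) then k else pos x

  sep′ : Vertex G → List (Vertex G)
  sep′ x = if does (x ≟ v) then X else sep x

  pos′<size : ∀ {x} → S x ≡ true → pos′ x < suc k
  pos′<size {x} Sx with x ≟ v
  ... | yes _  = ≤-refl
  ... | no x≢v = m<n⇒m<1+n (pos<size (S⁻-intro Sx x≢v))

  pos′-injective : ∀ {x y} → S x ≡ true → S y ≡ true → pos′ x ≡ pos′ y → x ≡ y
  pos′-injective {x} {y} Sx Sy eq with x ≟ v | y ≟ v
  ... | yes refl | yes refl = refl
  ... | yes refl | no y≢v   = contradiction (≡.sym eq) (<⇒≢ (pos<size (S⁻-intro Sy y≢v)))
  ... | no x≢v   | yes refl = contradiction eq (<⇒≢ (pos<size (S⁻-intro Sx x≢v)))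
  ... | no x≢v   | no y≢v   = pos-injective (S⁻-intro Sx x≢v) (S⁻-intro Sy y≢v) eq

  length-sep′ : ∀ {x} → S x ≡ true → length (sep′ x) ≤ ℓ
  length-sep′ {x} Sx with x ≟ v
  ... | yes _  = X≤
  ... | no x≢v = length-sep (S⁻-intro Sx x≢v)

  separates′ : ∀ {x} → S x ≡ true → Separates G r (λ u → S u ≡ true × pos′ u < pos′ x) x (sep′ x)
  separates′ {x} Sx {u} (Su , u<x) u≢x with x ≟ v | u ≟ v
  ... | yes refl | _      = X-separates Su u≢x
  ... | no x≢v | yes refl = contradiction (pos<size (S⁻-intro Sx x≢v)) (<-asym u<x)
  ... | no x≢v | no u≢v   = separates (S⁻-intro Sx x≢v) (S⁻-intro Su u≢v , u<x) u≢x

-- Greedy colouring along an order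

fresh : (xs : List (Fin (suc k))) → length xs ≤ k → ∃[ x ] x ∉ xs
fresh {k} xs xs≤k with any? (λ x → ¬? (x ∈? xs))
... | yes found = found
... | no ¬found = contradiction (begin
  suc k                                  ≡⟨ sum-one (suc k) ⟨
  ∑[ x < suc k ] 1                       ≤⟨ sum-mono all-in ⟩
  count (λ x → does (x ∈? xs))           ≤⟨ count-∈≤length xs ⟩
  length xs                              ≤⟨ xs≤k ⟩
  k                                      ∎) (<-irrefl refl)
  where
  open ≤-Reasoning
  all-in : ∀ x → 1 ≤ b2n (does (x ∈? xs))
  all-in x rewrite dec-true (x ∈? xs) (decidable-stable (x ∈? xs) (λ x∉ → ¬found (x , x∉))) = ≤-refl

-- Round `b` recolours the vertices at position `b`, avoiding the current colours on `T v`; smaller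
-- positions already have their final colours.
greedyColouring : (pos : Fin N → ℕ) (T : Fin N → List (Fin N)) → (∀ v → length (T v) ≤ k) →
  Σ (Fin N → Fin (suc k)) λ φ → ∀ {u v} → u ∈ T v → pos u < pos v → φ u ≢ φ v
greedyColouring {N} {k} pos T T≤ =
  -- `suc (sum pos)` exceeds every position, so all vertices have had their round.
  let φ , proper = go (suc (sum pos)) in φ , λ {u} {v} → proper (s≤s (term≤sum pos v))
  where
  go : ∀ b → Σ (Fin N → Fin (suc k)) λ φ → ∀ {u v} → pos v < b → u ∈ T v → pos u < pos v → φ u ≢ φ v
  go zero = (λ _ → zero) , λ ()
  go (suc b) with go b
  ... | φ , proper = φ′ , proper′
    where
    new : ∀ v → ∃[ x ] x ∉ map φ (T v)
    new v = fresh (map φ (T v)) (≤-trans (≤-reflexive (length-map φ (T v))) (T≤ v))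

    φ′ : Fin N → Fin (suc k)
    φ′ v = if does (pos v ≟ℕ b) then proj₁ (new v) else φ v

    φ′-old : ∀ {v} → pos v < b → φ′ v ≡ φ v
    φ′-old {v} v<b rewrite dec-false (pos v ≟ℕ b) (<⇒≢ v<b) = refl

    φ′-new : ∀ {v} → pos v ≡ b → φ′ v ≡ proj₁ (new v)
    φ′-new {v} v≡b rewrite dec-true (pos v ≟ℕ b) v≡b = refl

    proper′ : ∀ {u v} → pos v < suc b → u ∈ T v → pos u < pos v → φ′ u ≢ φ′ v
    proper′ {u} {v} v<1+b u∈ u<v eq with m<1+n⇒m<n∨m≡n v<1+b
    ... | inj₁ v<b = proper v<b u∈ u<v
      (trans (≡.sym (φ′-old (<-trans u<v v<b))) (trans eq (φ′-old v<b)))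
    ... | inj₂ v≡b = proj₂ (new v) (subst (_∈ map φ (T v))
      (trans (≡.sym (φ′-old (subst (pos u <_) v≡b u<v))) (trans eq (φ′-new v≡b))) (∈-map⁺ φ u∈))

-- Weak reachability through separators

length-concatMap : {A B : Set} (f : A → List B) → (∀ x → length (f x) ≤ k) →
  ∀ xs → length (concatMap f xs) ≤ length xs * k
length-concatMap f f≤ []       = z≤n
length-concatMap f f≤ (x ∷ xs) =
  ≤-trans (≤-reflexive (length-++ (f x))) (+-mono-≤ (f≤ x) (length-concatMap f f≤ xs))

-- Number of nodes of the `ℓ`-ary tree of depth `k`, the tree of possible jumps from a vertex into
-- its separator.
reachSize : ℕ → ℕ → ℕ
reachSize ℓ zero    = 1
reachSize ℓ (suc k) = suc (ℓ * reachSize ℓ k)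

module WeakReach {G : Graph} {r ℓ : ℕ} {size : ℕ} (order : SeparatorOrder G r ℓ (λ _ → true) size) where
  open SeparatorOrder order

  reach : ℕ → Vertex G → List (Vertex G)
  reach zero    v = v ∷ []
  reach (suc k) v = v ∷ concatMap (reach k) (sep v)

  length-reach : ∀ k v → length (reach k v) ≤ reachSize ℓ k
  length-reach zero    v = ≤-refl
  length-reach (suc k) v = s≤s (≤-trans (length-concatMap (reach k) (length-reach k) (sep v))
    (*-monoˡ-≤ (reachSize ℓ k) (length-sep {v} refl)))

  -- A walk from v to a smaller vertex meets sep v, and can be resumed from there with strictly fewer steps.
  minimum∈reach : ∀ {k v y} → k ≤ r → pos y ≤ pos v → WalkIn G (λ x → pos y ≤ pos x) k v y → y ∈ reach k v
  minimum∈reach {zero} _ _ here = here refl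
  minimum∈reach {suc k} {v} {y} k≤r y≤v walk with y ≟ v | walk-hits (sep v) walk
  ... | yes y≡v | _ = here y≡v
  ... | no y≢v | inj₁ avoiding = ⊥-elim
    (separates refl (refl , ≤∧≢⇒< y≤v (y≢v ∘ pos-injective refl refl)) y≢v (walk-mono k≤r avoiding))
  ... | no _   | inj₂ (x , l , x∈ , y≤x , l<k , walk′) = there (∈-concatMap⁺ (reach k)
    (lose x∈ (minimum∈reach (<⇒≤ k≤r) y≤x (walk-mono (s≤s⁻¹ l<k) walk′))))

  weakColouring : Σ (Vertex G → Fin (suc (reachSize ℓ r))) λ φ →
    ∀ {k v y} → k ≤ r → pos y < pos v → WalkIn G (λ x → pos y ≤ pos x) k v y → φ y ≢ φ v
  weakColouring with greedyColouring pos (reach r) (length-reach r)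
  ... | φ , proper = φ , λ k≤r y<v walk → proper (minimum∈reach ≤-refl (<⇒≤ y<v) (walk-mono k≤r walk)) y<v

-- Subcolouring traces of balls

argmin : (f : Fin N → ℕ) {P : Fin N → Set} → (∀ x → Dec (P x)) →
  (∃[ z ] (P z × ∀ w → P w → f z ≤ f w)) ⊎ (∀ w → ¬ P w)
argmin {zero}  f P? = inj₂ λ ()
argmin {suc N} f P? with P? zero | argmin (f ∘ suc) (P? ∘ suc)
... | no ¬P0 | inj₂ none = inj₂ λ { zero → ¬P0 ; (suc w) → none w }
... | no ¬P0 | inj₁ (z , Pz , z-min) = inj₁ (suc z , Pz , λ
  { zero P0 → contradiction P0 ¬P0 ; (suc w) → z-min w })
... | yes P0 | inj₂ none = inj₁ (zero , P0 , λ
  { zero _ → ≤-refl ; (suc w) Pw → contradiction Pw (none w) })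
... | yes P0 | inj₁ (z , Pz , z-min) with ≤-total (f zero) (f (suc z))
...   | inj₁ 0≤z = inj₁ (zero , P0 , λ { zero _ → ≤-refl ; (suc w) Pw → ≤-trans 0≤z (z-min w Pw) })
...   | inj₂ z≤0 = inj₁ (suc z , Pz , λ { zero _ → z≤0 ; (suc w) → z-min w })

-- The length `(d + d) + (d + d)` allows for four legs: from an anchor to its vertex, to the centre
-- of the ball, to the other vertex, to the other anchor.
module BallColouring (G : Graph) (d : ℕ) (Q : Subset (n G)) {C : ℕ}
  (pos : Vertex G → ℕ) (pos-injective : ∀ {u v} → pos u ≡ pos v → u ≡ v)
  (φ : Vertex G → Fin C)
  (φ-proper : ∀ {k v y} → k ≤ (d + d) + (d + d) → pos y < pos v →
    WalkIn G (λ x → pos y ≤ pos x) k v y → φ y ≢ φ v) where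

  Near : ℕ → Vertex G → Set
  Near b w = ∃[ q ] (q Subset.∈ Q × DistLe G b q w)

  -- The position `a` splits the budget `d` between the way from `w` to `x` and the way from `Q` to
  -- `w`; being in `Fin (suc d)`, it can be part of a colour.
  Between : Vertex G → Vertex G → Fin (suc d) → Set
  Between x w a = Near (d ∸ toℕ a) w × DistLe G (toℕ a) w x

  -- The vertices lying on walks of length ≤ d from x to Q.
  Relevant : Vertex G → Vertex G → Set
  Relevant x w = ∃[ a ] Between x w a

  dist? : ∀ k u v → Dec (DistLe G k u v)
  dist? = walk? (λ _ → yes tt)

  relevant? : ∀ x w → Dec (Relevant x w)
  relevant? x w = any? λ a → any? (λ q → q ∈Subset? Q ×-dec dist? _ q w) ×-dec dist? _ w x

  relevant : ∀ {a b w x} → a + b ≤ d → Near b w → DistLe G a w x → Relevant x w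
  relevant {a} {b} a+b≤d (q , q∈Q , qw) wx = fromℕ< (s≤s a≤d) , (q , q∈Q , walk-mono b≤ qw) , walk-mono (≤-reflexive (≡.sym a≡)) wx
    where
    a≤d = m+n≤o⇒m≤o a a+b≤d
    a≡  = toℕ-fromℕ< (s≤s a≤d)
    b≤ : b ≤ d ∸ toℕ (fromℕ< (s≤s a≤d))
    b≤ rewrite a≡ = m+n≤o⇒m≤o∸n b (≤-trans (≤-reflexive (+-comm b a)) a+b≤d)

  -- Each step moves one unit of the budget from the way to `x` to the way from `Q`, so the sum
  -- stays within `d`.
  relevant-walk : ∀ {a b w x} → a + b ≤ d → Near b w → DistLe G a w x → WalkIn G (Relevant x) a w x
  relevant-walk a+b≤d near here = here
  relevant-walk {suc a} {b} a+b≤d (q , q∈Q , qw) (step wz _ zx) =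
    step wz (relevant a+b′≤d near′ zx) (relevant-walk a+b′≤d near′ zx)
    where
    near′  = q , q∈Q , walk-snoc qw wz tt
    a+b′≤d = ≤-trans (≤-reflexive (+-suc a b)) a+b≤d

  Anchored : Vertex G → Vertex G → Fin (suc d) → Set
  Anchored x z a = Between x z a × (∀ {w} → Relevant x w → pos z ≤ pos w)

  -- x itself is only a junk value, for vertices outside all the balls.
  anchoring : ∀ x → ∃[ z ] ∃[ a ] (∀ {w} → Relevant x w → Anchored x z a)
  anchoring x with argmin pos (relevant? x)
  ... | inj₁ (z , (a , between) , z-min) = z , a , λ _ → between , λ {w} → z-min w
  ... | inj₂ none = x , zero , λ {w} rel → contradiction rel (none w)

  anchor : Vertex G → Vertex G
  anchor x = proj₁ (anchoring x)

  level : Vertex G → Fin (suc d)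
  level x = proj₁ (proj₂ (anchoring x))

  anchored : ∀ {x w} → Relevant x w → Anchored x (anchor x) (level x)
  anchored {x} = proj₂ (proj₂ (anchoring x))

  colour : Vertex G → Fin (C * suc d)
  colour x = combine (φ (anchor x)) (level x)

  module _ {q} (q∈Q : q Subset.∈ Q) where

    private
      q-near : Near 0 q
      q-near = q , q∈Q , here

      d+0≤d : d + 0 ≤ d
      d+0≤d = ≤-reflexive (+-identityʳ d)

    ball-anchored : ∀ {x} → DistLe G d q x → Anchored x (anchor x) (level x)
    ball-anchored qx = anchored (relevant d+0≤d q-near qx)

    module _ {x} (qx : DistLe G d q x) where

      private
        level≤d = s≤s⁻¹ (toℕ<n (level x))
        level+rest≤d = ≤-reflexive (m+[n∸m]≡n level≤d)
        near    = proj₁ (proj₁ (ball-anchored qx))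
        zx      = proj₂ (proj₁ (ball-anchored qx))

      anchor-walk : WalkIn G (Relevant x) (d + d) (anchor x) q
      anchor-walk = walk-++
        (walk-mono level≤d (relevant-walk level+rest≤d near zx))
        (walk-reverse (relevant d+0≤d q-near qx) (relevant-walk d+0≤d q-near qx))

    -- On the walk from `anchor x` through `x`, `q` and `y` to `anchor y`, the first half is
    -- relevant to `x` and the second to `y`. No vertex is therefore below `anchor y`, and if that
    -- were strictly below `anchor x`, `φ` would distinguish them.
    smaller-anchor : ∀ {x y} → DistLe G d q x → DistLe G d q y → φ (anchor x) ≡ φ (anchor y) →
      pos (anchor y) ≤ pos (anchor x) → anchor x ≡ anchor y
    smaller-anchor {x} {y} qx qy φ≡ y≤x with m≤n⇒m<n∨m≡n y≤x
    ... | inj₂ y≡x = pos-injective (≡.sym y≡x)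
    ... | inj₁ y<x = contradiction (≡.sym φ≡) (φ-proper ≤-refl y<x (walk-++
      (walk-map (λ rel → ≤-trans y≤x (proj₂ (ball-anchored qx) rel)) (anchor-walk qx))
      (walk-reverse ≤-refl (walk-map (proj₂ (ball-anchored qy)) (anchor-walk qy)))))

    same-anchor : ∀ {x y} → DistLe G d q x → DistLe G d q y → φ (anchor x) ≡ φ (anchor y) →
      anchor x ≡ anchor y
    same-anchor {x} {y} qx qy φ≡ with ≤-total (pos (anchor y)) (pos (anchor x))
    ... | inj₁ y≤x = smaller-anchor qx qy φ≡ y≤x
    ... | inj₂ x≤y = ≡.sym (smaller-anchor qy qx (≡.sym φ≡) x≤y)

  module _ (W : Subset (n G)) where

    private
      Point = U (BallTrace G d W Q)
      Adj = GaifmanAdj (BallTrace G d W Q)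

    -- What propagates along a monochromatic path, where a common ball need not. The `Between` parts
    -- certify that the anchors are genuine.
    Linked : Point → Point → Set
    Linked (x , _) (y , _) = anchor x ≡ anchor y × level x ≡ level y
      × Between x (anchor x) (level x) × Between y (anchor y) (level y)

    adjacent⇒linked : ∀ {x y : Point} → Adj x y → colour (proj₁ x) ≡ colour (proj₁ y) → Linked x y
    adjacent⇒linked {x , _} {y , _} (_ , (q , q∈Q) , qx , qy) same
      with combine-injective (φ (anchor x)) (level x) (φ (anchor y)) (level y) same
    ... | φ≡ , level≡ = same-anchor q∈Q qx qy φ≡ , level≡ ,
      proj₁ (ball-anchored q∈Q qx) , proj₁ (ball-anchored q∈Q qy)

    path-start : ∀ {P : Point → Set} {x y} → PathIn Adj P x y → P x
    path-start (here Px)     = Px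
    path-start (step Px _ _) = Px

    path⇒linked : ∀ {i} {x y : Point} → PathIn Adj (λ p → colour (proj₁ p) ≡ i) x y → x ≡ y ⊎ Linked x y
    path⇒linked (here _) = inj₁ refl
    path⇒linked (step x∈i xz path)
      with adjacent⇒linked xz (trans x∈i (≡.sym (path-start path))) | path⇒linked path
    ... | xz-linked                  | inj₁ refl = inj₂ xz-linked
    ... | anchor≡ , level≡ , bx , _ | inj₂ (anchor≡′ , level≡′ , _ , by) =
      inj₂ (trans anchor≡ anchor≡′ , trans level≡ level≡′ , bx , by)

    -- The element of Q nearest to the common anchor is close enough to both points because they have the same level.
    linked⇒adjacent : ∀ {x y : Point} → x ≢ y → Linked x y → Adj x y
    linked⇒adjacent {x , _} {y , _} x≢y (anchor≡ , level≡ , ((q , q∈Q , qz) , zx) , (_ , zy)) =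
      x≢y , (q , q∈Q) , extend zx , extend (≡.subst₂ (λ z a → DistLe G (toℕ a) z y) (≡.sym anchor≡) (≡.sym level≡) zy)
      where
      extend : ∀ {w} → DistLe G (toℕ (level x)) (anchor x) w → DistLe G d q w
      extend zw = walk-mono (≤-reflexive (m∸n+n≡m (s≤s⁻¹ (toℕ<n (level x))))) (walk-++ qz zw)

    point-≟ : (x y : Point) → Dec (x ≡ y)
    point-≟ (x , x∈W) (y , y∈W) with x ≟ y
    ... | yes refl = yes (cong (x ,_) ([]=-irrelevant x∈W y∈W))
    ... | no x≢y   = no (x≢y ∘ cong proj₁)

    subcolouring : IsSubcoloring Adj (C * suc d) (colour ∘ proj₁)
    subcolouring i x y path with point-≟ x y | path⇒linked path
    -- A path may return to its start, and `Linked` does not exclude equality, while Gaifman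
    -- adjacency does.
    ... | yes x≡y | _           = inj₁ x≡y
    ... | no x≢y  | inj₁ x≡y    = inj₁ x≡y
    ... | no x≢y  | inj₂ linked = inj₂ (linked⇒adjacent x≢y linked)

theorem3p3 : ∀ (d : ℕ) (𝒞 : Graph → Set) → BoundedExpansion 𝒞 →
    ∃[ s ] (∀ (G : Graph) → 𝒞 G → (W Q : Subset (n G)) →
    SubchromaticLe s (BallTrace G d W Q))
theorem3p3 d 𝒞 expansion = suc (reachSize ℓ r) * suc d , λ G G∈𝒞 W Q →
  let order        = separatorOrder (separator {G} {r} {c} {c′} (dense G G∈𝒞) (dense′ G G∈𝒞)) _ (λ _ → true) refl
      φ , φ-proper = WeakReach.weakColouring order
      open SeparatorOrder order
      open BallColouring G d Q pos (pos-injective refl refl) φ φ-proper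
  in colour ∘ proj₁ , subcolouring W
  where
  -- Walks between anchors have length at most `r`. Depth `r + r` serves the saturated minor, depth
  -- `r` the contraction of the regions.
  r  = (d + d) + (d + d)
  c  = proj₁ (expansion (r + r))
  c′ = proj₁ (expansion r)
  ℓ  = separatorSize r c c′

  dense : ∀ G → 𝒞 G → DepthMinorDensity G (r + r) c
  dense = proj₂ (expansion (r + r))

  dense′ : ∀ G → 𝒞 G → DepthMinorDensity G r c′
  dense′ = proj₂ (expansion r)
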